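{- (1) Every unary query computable by a 2-GNN all of whose layers use $\mathrm{MAX}$ aggregation is computable by a 1-GNN all of whose layers use $\mathrm{MAX}$ aggregation. (2) Every unary query computable by a 2-GNN all of whose layers use $\mathrm{MEAN}$ aggregation is computable by a 1-GNN all of whose layers use $\mathrm{MEAN}$ aggregation.
   Context: Graphs are finite, simple, undirected; an $\ell$-labelled graph has unary relations $P_1,\dots,P_\ell$ and is identified with the Boolean signal $\mathcal b:V(G)\to\{0,1\}^\ell$, $\mathcal b(v)_i=1\iff v\in P_i(G)$. A unary query maps each $\ell$-labelled graph $G$ to an isomorphism-invariant set $\mathcal Q(G)\subseteq V(G)$. An FNN is a composition of layers $\vec x\mapsto\sigma(A\vec x+\vec b)$ with rational $A,\vec b$ and $\sigma\in\{\mathrm{ReLU},\mathrm{id}\}$ applied coordinatewise. A 1-GNN layer is a triple $(\mathrm{msg},\mathrm{agg},\mathrm{comb})$ with $\mathrm{msg}:\mathbb R^p\to\mathbb R^r$, $\mathrm{comb}:\mathbb R^{p+r}\to\mathbb R^q$ computed by FNNs and $\mathrm{agg}\in\{\mathrm{SUM},\mathrm{MEAN},\mathrm{MAX}\}$ (coordinatewise sum, arithmetic mean, maximum over a finite multiset; $\vec 0$ on the empty multiset), mapping a signal $\mathcal f$ to $\mathcal f'(v)=\mathrm{comb}\big(\mathcal f(v),\mathrm{agg}(\{\!\{\mathrm{msg}(\mathcal f(w)):w\in N_G(v)\}\!\})\big)$; a 2-GNN layer is the same with $\mathrm{msg}:\mathbb R^{2p}\to\mathbb R^r$ and messages $\mathrm{msg}(\mathcal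 f(v),\mathcal f(w))$. An $i$-GNN is a sequence of $i$-GNN layers with matching dimensions computing their composition; $S_{\mathfrak N}(G,\mathcal b)$ is its output. A GNN $\mathfrak N$ with input dimension $\ell$ and output dimension $1$ computes $\mathcal Q$ if for all $\ell$-labelled $G$ and $v\in V(G)$: $S_{\mathfrak N}(G,\mathcal b)(v)\ge3/4$ if $v\in\mathcal Q(G)$ and $\le 1/4$ otherwise. -}

module Defs where

open import Data.Bool using (Bool; true; false; if_then_else_)
open import Data.Nat as ℕ using (ℕ; zero; suc)
open import Data.Integer using (+_)
open import Data.Fin using (Fin)
open import Data.Vec as Vec using (Vec; []; _∷_; _++_; head)
open import Data.List as List using (List; []; _∷_; filter; length; allFin)
open import Data.Rational using (ℚ; 0ℚ; 1ℚ; _+_; _*_; _⊔_; _/_; _≤_)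
open import Data.Product using (Σ; _×_; _,_)
open import Function.Bundles using (_↔_; Inverse)
open import Relation.Binary.PropositionalEquality using (_≡_)
open import Relation.Nullary using (¬_)
open import Relation.Nullary.Decidable using (does)
open import Data.Bool.Properties using (_≟_)

record LGraph (ℓ : ℕ) : Set where
  field
    n      : ℕ
    adj    : Fin n → Fin n → Bool
    sym    : ∀ u v → adj u v ≡ adj v u
    irrefl : ∀ v → adj v v ≡ false
    label  : Fin n → Fin ℓ → Bool
open LGraph public

record Iso {ℓ : ℕ} (G H : LGraph ℓ) : Set where
  field
    bij      : Fin (n G) ↔ Fin (n H)
    adj-pres : ∀ u v → adj H (Inverse.to bij u) (Inverse.to bij v) ≡ adj G u v
    lab-pres : ∀ v i → label H (Inverse.to bij v) i ≡ label G v i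
open Iso public

record Query (ℓ : ℕ) : Set₁ where
  field
    Q         : (G : LGraph ℓ) → Fin (n G) → Set
    invariant : ∀ {G H : LGraph ℓ} (π : Iso G H) (v : Fin (n G)) →
                (Q G v → Q H (Inverse.to (bij π) v)) × (Q H (Inverse.to (bij π) v) → Q G v)
open Query public

data Act : Set where
  relu ident : Act

act : Act → ℚ → ℚ
act relu x  = 0ℚ ⊔ x
act ident x = x

record FLayer (p q : ℕ) : Set where
  field
    A : Vec (Vec ℚ p) q
    b : Vec ℚ q
    σ : Act
open FLayer public

dot : ∀ {p} → Vec ℚ p → Vec ℚ p → ℚ
dot []       []       = 0ℚ
dot (a ∷ as) (x ∷ xs) = a * x + dot as xs

evalFLayer : ∀ {p q} → FLayer p q → Vec ℚ p → Vec ℚ q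
evalFLayer L x = Vec.map (act (σ L)) (Vec.zipWith _+_ (Vec.map (λ row → dot row x) (A L)) (b L))

data FNN : ℕ → ℕ → Set where
  layer : ∀ {p q} → FLayer p q → FNN p q
  _▸_   : ∀ {p q r} → FNN p q → FLayer q r → FNN p r

evalFNN : ∀ {p q} → FNN p q → Vec ℚ p → Vec ℚ q
evalFNN (layer L) x = evalFLayer L x
evalFNN (N ▸ L)   x = evalFLayer L (evalFNN N x)

-- Aggregation functions on finite multisets (given as lists)

data Agg : Set where
  SUM MEAN MAX : Agg

zeros : ∀ {r} → Vec ℚ r
zeros = Vec.replicate _ 0ℚ

vsum : ∀ {r} → List (Vec ℚ r) → Vec ℚ r
vsum = List.foldr (Vec.zipWith _+_) zeros

aggregate : Agg → ∀ {r} → List (Vec ℚ r) → Vec ℚ r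
aggregate SUM  xs       = vsum xs
aggregate MEAN []       = zeros
aggregate MEAN (x ∷ xs) = Vec.map (λ y → ((+ 1) / suc (length xs)) * y) (vsum (x ∷ xs))
aggregate MAX  []       = zeros
aggregate MAX  (x ∷ xs) = List.foldr (Vec.zipWith _⊔_) x xs

Signal : ∀ {ℓ} → LGraph ℓ → ℕ → Set
Signal G p = Fin (n G) → Vec ℚ p

neighbours : ∀ {ℓ} (G : LGraph ℓ) → Fin (n G) → List (Fin (n G))
neighbours G v = filter (λ w → adj G v w ≟ true) (allFin (n G))

inputSignal : ∀ {ℓ} (G : LGraph ℓ) → Signal G ℓ
inputSignal G v = Vec.tabulate (λ i → if label G v i then 1ℚ else 0ℚ)

record Layer1 (a : Agg) (p q : ℕ) : Set where
  field
    r    : ℕ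
    msg  : FNN p r
    comb : FNN (p ℕ.+ r) q

record Layer2 (a : Agg) (p q : ℕ) : Set where
  field
    r    : ℕ
    msg  : FNN (p ℕ.+ p) r
    comb : FNN (p ℕ.+ r) q

applyLayer1 : ∀ {a p q ℓ} → Layer1 a p q → (G : LGraph ℓ) → Signal G p → Signal G q
applyLayer1 {a} L G f v =
  evalFNN (Layer1.comb L)
    (f v ++ aggregate a (List.map (λ w → evalFNN (Layer1.msg L) (f w)) (neighbours G v)))

applyLayer2 : ∀ {a p q ℓ} → Layer2 a p q → (G : LGraph ℓ) → Signal G p → Signal G q
applyLayer2 {a} L G f v =
  evalFNN (Layer2.comb L)
    (f v ++ aggregate a (List.map (λ w → evalFNN (Layer2.msg L) (f v ++ f w)) (neighbours G v)))

data GNN1 (a : Agg) : ℕ → ℕ → Set where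
  []  : ∀ {p} → GNN1 a p p
  _∷_ : ∀ {p q s} → Layer1 a p q → GNN1 a q s → GNN1 a p s

data GNN2 (a : Agg) : ℕ → ℕ → Set where
  []  : ∀ {p} → GNN2 a p p
  _∷_ : ∀ {p q s} → Layer2 a p q → GNN2 a q s → GNN2 a p s

runGNN1 : ∀ {a p q ℓ} → GNN1 a p q → (G : LGraph ℓ) → Signal G p → Signal G q
runGNN1 []       G f = f
runGNN1 (L ∷ Ls) G f = runGNN1 Ls G (applyLayer1 L G f)

runGNN2 : ∀ {a p q ℓ} → GNN2 a p q → (G : LGraph ℓ) → Signal G p → Signal G q
runGNN2 []       G f = f
runGNN2 (L ∷ Ls) G f = runGNN2 Ls G (applyLayer2 L G f)

ComputesVia : ∀ {ℓ} → Query ℓ → ((G : LGraph ℓ) → Signal G 1) → Set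
ComputesVia 𝒬 S = ∀ (G : _) (v : Fin (n G)) →
  (Q 𝒬 G v → ((+ 3) / 4) ≤ head (S G v)) × (¬ Q 𝒬 G v → head (S G v) ≤ ((+ 1) / 4))

Computes1 : ∀ {a ℓ} → GNN1 a ℓ 1 → Query ℓ → Set
Computes1 N 𝒬 = ComputesVia 𝒬 (λ G → runGNN1 N G (inputSignal G))

Computes2 : ∀ {a ℓ} → GNN2 a ℓ 1 → Query ℓ → Set
Computes2 N 𝒬 = ComputesVia 𝒬 (λ G → runGNN2 N G (inputSignal G))

Computable1 : Agg → ∀ {ℓ} → Query ℓ → Set
Computable1 a {ℓ} 𝒬 = Σ (GNN1 a ℓ 1) (λ N → Computes1 N 𝒬)

Computable2 : Agg → ∀ {ℓ} → Query ℓ → Set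
Computable2 a {ℓ} 𝒬 = Σ (GNN2 a ℓ 1) (λ N → Computes2 N 𝒬)

{-# OPTIONS --safe #-}
-- Both MAX and MEAN are nonexpansive in the sup norm, so on bounded signals the aggregate
-- m(x) = agg_w msg(x, f(w)) is a K-Lipschitz function of the receiver's state x. Choosing a δ-net
-- of the bounded set of states, a 1-GNN sends msg(c, f(w)) for every c in the net and thus learns
-- all m(c); the ReLU-computable function min_c (m(c) + K ‖x - c‖∞) is then within 2Kδ of m(x).
-- As 2-GNN layers are Lipschitz, these errors propagate controllably through the network, and a final
-- affine layer x ↦ 2x - 1/2 restores the thresholds 3/4 and 1/4.
module Submission where

open import Defs
open import Data.Bool using (Bool; true; false; if_then_else_)
open import Data.Fin using (Fin; zero; suc)
open import Data.Integer as ℤ using (+_)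
import Data.Integer.Properties as ℤ
open import Data.List as List using (List; []; _∷_; length; cartesianProductWith)
import Data.List.Properties as List
open import Data.List.Relation.Unary.Any using (Any; here; there)
open import Data.List.Relation.Unary.Any.Properties using (cartesianProductWith⁺)
open import Data.Nat as ℕ using (ℕ; zero; suc)
open import Data.Product using (Σ; ∃; _×_; _,_; proj₁; proj₂)
open import Data.Rational using (ℚ; 0ℚ; 1ℚ; ½; _+_; _*_; -_; _-_; _⊔_; _⊓_; _/_; 1/_; _≤_; _<_)
open import Data.Rational using (positive; nonNegative; nonPositive; toℚᵘ; fromℚᵘ; mkℚ)
open import Data.Rational.Properties
open import Data.Rational.Solver using (module +-*-Solver)
open import Data.Rational.Unnormalised as ℚᵘ using (mkℚᵘ; *≡*; *≤*)
import Data.Rational.Unnormalised.Properties as ℚᵘ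
open import Data.Sum using (inj₁; inj₂)
open import Data.Vec as Vec using (Vec; []; _∷_; _++_; replicate; zipWith)
open import Data.Vec.Properties using (map-++; map-cong; map-∘; map-id; map-replicate)
open import Data.Vec.Properties using (zipWith-identityˡ; zipWith-identityʳ)
open import Data.Vec.Properties using (zipWith-++; zipWith-replicate)
open import Data.Vec.Relation.Binary.Pointwise.Inductive as PW using (Pointwise; []; _∷_)
open import Function using (id)
open import Relation.Binary.PropositionalEquality using (_≡_; refl; trans; cong; cong₂; subst; subst₂)
open import Relation.Binary.PropositionalEquality using (module ≡-Reasoning) renaming (sym to ≡-sym)
open +-*-Solver using (solve; _:=_; _:+_; _:*_; :-_; con)

-- The obstacle is that a sender cannot see the receiver's state, while `msg` may mix the two states
-- nonlinearly. The net, the Lipschitz constants and all bounds must be fixed before the graph is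
-- known. This is possible because labels are Boolean and no estimate depends on the degree; the
-- latter is where `SUM` would break the argument. Selecting the nearest net point would be
-- discontinuous, hence beyond ReLU networks, and a partition of unity would multiply its weights
-- with received values; a minimum of cones avoids both. Since both aggregations act coordinatewise,
-- the messages for all net points fit into one longer message. The outcome is an approximation and
-- not an equality; the gap between 1/4 and 3/4 is what turns it into a computation of the same
-- query.

-- Approximate equality, Lipschitz maps and boundedness in the sup norm.

infix 4 _≈[_]_ _≋[_]_

-- This is |a - b| ≤ ε, split into two inequalities free of subtraction, so that monotonicity of
-- `_+_` and `_⊔_` applies to each half directly.
record _≈[_]_ (a ε b : ℚ) : Set where
  constructor _,_
  field
    upper : a ≤ b + ε
    lower : b ≤ a + ε
open _≈[_]_

_≋[_]_ : ∀ {n} → Vec ℚ n → ℚ → Vec ℚ n → Set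
x ≋[ ε ] y = Pointwise _≈[ ε ]_ x y

p≤p+q : ∀ {p q} → 0ℚ ≤ q → p ≤ p + q
p≤p+q {p} 0≤q = subst (_≤ p + _) (+-identityʳ p) (+-monoʳ-≤ p 0≤q)

q≤p+q : ∀ {p q} → 0ℚ ≤ p → q ≤ p + q
q≤p+q {p} {q} 0≤p = subst (q ≤_) (+-comm q p) (p≤p+q 0≤p)

*-nonneg : ∀ {p q} → 0ℚ ≤ p → 0ℚ ≤ q → 0ℚ ≤ p * q
*-nonneg {p} {q} 0≤p 0≤q =
  subst (_≤ p * q) (*-zeroʳ p) (*-monoˡ-≤-nonNeg p {{nonNegative 0≤p}} 0≤q)

+-nonneg : ∀ {p q} → 0ℚ ≤ p → 0ℚ ≤ q → 0ℚ ≤ p + q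
+-nonneg 0≤p 0≤q = ≤-trans 0≤p (p≤p+q 0≤q)

≈-refl : ∀ {ε a} → 0ℚ ≤ ε → a ≈[ ε ] a
≈-refl 0≤ε = p≤p+q 0≤ε , p≤p+q 0≤ε

≈-weaken : ∀ {ε δ a b} → ε ≤ δ → a ≈[ ε ] b → a ≈[ δ ] b
≈-weaken {a = a} {b} ε≤δ (a≤b , b≤a) =
  ≤-trans a≤b (+-monoʳ-≤ b ε≤δ) , ≤-trans b≤a (+-monoʳ-≤ a ε≤δ)

≤-trans-+ : ∀ a b c ε δ → a ≤ b + ε → b ≤ c + δ → a ≤ c + (ε + δ)
≤-trans-+ a b c ε δ a≤b b≤c = begin
  a            ≤⟨ a≤b ⟩
  b + ε        ≤⟨ +-monoˡ-≤ ε b≤c ⟩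
  (c + δ) + ε  ≡⟨ solve 3 (λ c δ ε → (c :+ δ) :+ ε := c :+ (ε :+ δ)) refl c δ ε ⟩
  c + (ε + δ)  ∎
  where open ≤-Reasoning

≈-trans : ∀ {a b c ε δ} → a ≈[ ε ] b → b ≈[ δ ] c → a ≈[ ε + δ ] c
≈-trans {a} {b} {c} {ε} {δ} (a≤b , b≤a) (b≤c , c≤b) =
  ≤-trans-+ a b c ε δ a≤b b≤c ,
  subst (λ e → c ≤ a + e) (+-comm δ ε) (≤-trans-+ c b a δ ε c≤b b≤a)

+-interchange-≤ : ∀ a b c d ε δ → a ≤ b + ε → c ≤ d + δ → a + c ≤ (b + d) + (ε + δ)
+-interchange-≤ a b c d ε δ a≤b c≤d =
  subst (a + c ≤_)
    (solve 4 (λ b d ε δ → (b :+ ε) :+ (d :+ δ) := (b :+ d) :+ (ε :+ δ)) refl b d ε δ)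
    (+-mono-≤ a≤b c≤d)

≈-+ : ∀ {a b c d ε δ} → a ≈[ ε ] b → c ≈[ δ ] d → a + c ≈[ ε + δ ] b + d
≈-+ {a} {b} {c} {d} {ε} {δ} (a≤b , b≤a) (c≤d , d≤c) =
  +-interchange-≤ a b c d ε δ a≤b c≤d , +-interchange-≤ b a d c ε δ b≤a d≤c

≈-+-constʳ : ∀ {a b ε} c → a ≈[ ε ] b → a + c ≈[ ε ] b + c
≈-+-constʳ {a} {b} {ε} c a≈b =
  subst (a + c ≈[_] b + c) (+-identityʳ ε) (≈-+ a≈b (≈-refl {a = c} ≤-refl))

⊔-mono-+ : ∀ a b c d ε → a ≤ b + ε → c ≤ d + ε → a ⊔ c ≤ (b ⊔ d) + ε
⊔-mono-+ a b c d ε a≤b c≤d =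
  ⊔-lub (≤-trans a≤b (+-monoˡ-≤ ε (p≤p⊔q b d))) (≤-trans c≤d (+-monoˡ-≤ ε (p≤q⊔p b d)))

≈-⊔ : ∀ {a b c d ε} → a ≈[ ε ] b → c ≈[ ε ] d → a ⊔ c ≈[ ε ] b ⊔ d
≈-⊔ {a} {b} {c} {d} {ε} (a≤b , b≤a) (c≤d , d≤c) =
  ⊔-mono-+ a b c d ε a≤b c≤d , ⊔-mono-+ b a d c ε b≤a d≤c

≈-scale : ∀ {c a b ε} → 0ℚ ≤ c → a ≈[ ε ] b → c * a ≈[ c * ε ] c * b
≈-scale {c} {a} {b} {ε} 0≤c (a≤b , b≤a) = side a b ε a≤b , side b a ε b≤a
  where
  side : ∀ a b ε → a ≤ b + ε → c * a ≤ c * b + c * ε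
  side a b ε a≤b =
    subst (c * a ≤_) (*-distribˡ-+ c b ε) (*-monoˡ-≤-nonNeg c {{nonNegative 0≤c}} a≤b)

-- A factor `c ≤ 0` reverses the order, so each half of the conclusion comes from the opposite half
-- of the hypothesis, with modulus `- c` = |c|.
≈-scale-neg : ∀ {c a b ε} → c ≤ 0ℚ → a ≈[ ε ] b → c * a ≈[ - c * ε ] c * b
≈-scale-neg {c} {a} {b} {ε} c≤0 (a≤b , b≤a) = side a b ε b≤a , side b a ε a≤b
  where
  side : ∀ a b ε → b ≤ a + ε → c * a ≤ c * b + - c * ε
  side a b ε b≤a = begin
    c * a                     ≡⟨ solve 3 (λ c a ε → c :* a := c :* (a :+ ε) :+ (:- c) :* ε) refl c a ε ⟩
    c * (a + ε) + - c * ε     ≤⟨ +-monoˡ-≤ (- c * ε) (*-monoˡ-≤-nonPos c {{nonPositive c≤0}} b≤a) ⟩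
    c * b + - c * ε           ∎
    where open ≤-Reasoning

≋-refl : ∀ {n ε} {x : Vec ℚ n} → 0ℚ ≤ ε → x ≋[ ε ] x
≋-refl 0≤ε = PW.refl (≈-refl 0≤ε)

≋-trans : ∀ {n ε δ} {x y z : Vec ℚ n} → x ≋[ ε ] y → y ≋[ δ ] z → x ≋[ ε + δ ] z
≋-trans = PW.trans ≈-trans

≋-weaken : ∀ {n ε δ} {x y : Vec ℚ n} → ε ≤ δ → x ≋[ ε ] y → x ≋[ δ ] y
≋-weaken ε≤δ = PW.map (≈-weaken ε≤δ)

-- The modulus is data because the weights and the net of the 1-GNN are computed from it. The
-- condition `0ℚ ≤ ε` is explicit because vectors of dimension 0 satisfy `x ≋[ ε ] y` even for
-- negative `ε`.
record Lipschitz {p q} (f : Vec ℚ p → Vec ℚ q) : Set where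
  constructor lip
  field
    modulus  : ℚ
    modulus≥0 : 0ℚ ≤ modulus
    close    : ∀ {ε x y} → 0ℚ ≤ ε → x ≋[ ε ] y → f x ≋[ modulus * ε ] f y
open Lipschitz

scale-modulus : ∀ c → Σ ℚ λ K → 0ℚ ≤ K × (∀ {a b ε} → a ≈[ ε ] b → c * a ≈[ K * ε ] c * b)
scale-modulus c with ≤-total 0ℚ c
... | inj₁ 0≤c = c , 0≤c , ≈-scale 0≤c
... | inj₂ c≤0 = - c , neg-antimono-≤ c≤0 , ≈-scale-neg c≤0

-- The modulus is the ℓ¹ norm of `a`, dual to the sup norm on the arguments.
dot-modulus : ∀ {p} (a : Vec ℚ p) →
  Σ ℚ λ K → 0ℚ ≤ K × (∀ {x y ε} → 0ℚ ≤ ε → x ≋[ ε ] y → dot a x ≈[ K * ε ] dot a y)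
dot-modulus [] = 0ℚ , ≤-refl , λ { 0≤ε [] → ≈-refl (*-nonneg ≤-refl 0≤ε) }
dot-modulus (a ∷ as) with scale-modulus a | dot-modulus as
... | K , 0≤K , near | Ks , 0≤Ks , nears = K + Ks , +-nonneg 0≤K 0≤Ks , both
  where
  both : ∀ {x y ε} → 0ℚ ≤ ε → x ≋[ ε ] y → dot (a ∷ as) x ≈[ (K + Ks) * ε ] dot (a ∷ as) y
  both {ε = ε} 0≤ε (x≈y ∷ xs≈ys) =
    subst (_ ≈[_] _) (≡-sym (*-distribʳ-+ ε K Ks)) (≈-+ (near x≈y) (nears 0≤ε xs≈ys))

act-nonexpansive : ∀ σ {a b ε} → 0ℚ ≤ ε → a ≈[ ε ] b → act σ a ≈[ ε ] act σ b
act-nonexpansive relu  0≤ε a≈b = ≈-⊔ (≈-refl {a = 0ℚ} 0≤ε) a≈b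
act-nonexpansive ident 0≤ε a≈b = a≈b

*-monoˡ : ∀ K L ε → 0ℚ ≤ ε → K ≤ L → K * ε ≤ L * ε
*-monoˡ _ _ ε 0≤ε = *-monoʳ-≤-nonNeg ε {{nonNegative 0≤ε}}

*-monoʳ : ∀ {K ε δ} → 0ℚ ≤ K → ε ≤ δ → K * ε ≤ K * δ
*-monoʳ {K} 0≤K = *-monoˡ-≤-nonNeg K {{nonNegative 0≤K}}

FLayer-lipschitz : ∀ {p q} (L : FLayer p q) → Lipschitz (evalFLayer L)
FLayer-lipschitz record { A = [] ; b = [] ; σ = σ } = lip 0ℚ ≤-refl λ _ _ → []
FLayer-lipschitz record { A = a ∷ as ; b = b ∷ bs ; σ = σ }
  with dot-modulus a | FLayer-lipschitz record { A = as ; b = bs ; σ = σ }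
... | K , 0≤K , near | lip Ks 0≤Ks nears =
  -- The sum of the row moduli stands in for their maximum: it dominates each of them, and any
  -- finite constant will do.
  lip (K + Ks) (+-nonneg 0≤K 0≤Ks) λ 0≤ε x≈y →
    ≈-weaken (*-monoˡ K (K + Ks) _ 0≤ε (p≤p+q 0≤Ks))
      (act-nonexpansive σ (*-nonneg 0≤K 0≤ε) (≈-+-constʳ b (near 0≤ε x≈y)))
    ∷ ≋-weaken (*-monoˡ Ks (K + Ks) _ 0≤ε (q≤p+q 0≤K)) (nears 0≤ε x≈y)

FNN-lipschitz : ∀ {p q} (N : FNN p q) → Lipschitz (evalFNN N)
FNN-lipschitz (layer L) = FLayer-lipschitz L
FNN-lipschitz (N ▸ L) with FNN-lipschitz N | FLayer-lipschitz L
... | lip K 0≤K near | lip K′ 0≤K′ near′ =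
  lip (K′ * K) (*-nonneg 0≤K′ 0≤K) λ {ε} 0≤ε x≈y →
    subst (_ ≋[_] _) (≡-sym (*-assoc K′ K ε)) (near′ (*-nonneg 0≤K 0≤ε) (near 0≤ε x≈y))

-- Boundedness is encoded as closeness to the origin, so that Lipschitz estimates and `≋-trans` also
-- transport bounds.
Bounded : ∀ {n} → ℚ → Vec ℚ n → Set
Bounded M x = zeros ≋[ M ] x

bounded-of : ∀ {n} (x : Vec ℚ n) → Σ ℚ λ M → 0ℚ ≤ M × Bounded M x
bounded-of [] = 0ℚ , ≤-refl , []
bounded-of (x ∷ xs) with bounded-of xs
... | M , 0≤M , M-xs = (x ⊔ - x) ⊔ M , ≤-trans 0≤M (p≤q⊔p (x ⊔ - x) M) ,
  (subst (_≤ x + ((x ⊔ - x) ⊔ M)) (+-inverseʳ x)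
     (+-monoʳ-≤ x (≤-trans (p≤q⊔p x (- x)) (p≤p⊔q (x ⊔ - x) M)))
  , subst (x ≤_) (≡-sym (+-identityˡ _)) (≤-trans (p≤p⊔q x (- x)) (p≤p⊔q (x ⊔ - x) M)))
  ∷ ≋-weaken (p≤q⊔p (x ⊔ - x) M) M-xs

-- On the ball of radius `M` the network strays at most `K * M` from its value at the origin.
FNN-bounded : ∀ {p q} (N : FNN p q) {M} → 0ℚ ≤ M →
  Σ ℚ λ B → 0ℚ ≤ B × (∀ {x} → Bounded M x → Bounded B (evalFNN N x))
FNN-bounded N {M} 0≤M with FNN-lipschitz N | bounded-of (evalFNN N zeros)
... | lip K 0≤K near | B₀ , 0≤B₀ , B₀-N =
  B₀ + K * M , +-nonneg 0≤B₀ (*-nonneg 0≤K 0≤M) , λ M-x → ≋-trans B₀-N (near 0≤M M-x)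

-- Matrices as layers, composition of FNNs, and carrying coordinates past a network.

_·_ : ∀ {p q} → Vec (Vec ℚ p) q → Vec ℚ p → Vec ℚ q
A · x = Vec.map (λ row → dot row x) A

dot-zeros : ∀ {n} (x : Vec ℚ n) → dot zeros x ≡ 0ℚ
dot-zeros []       = refl
dot-zeros (x ∷ xs) = trans (cong₂ _+_ (*-zeroˡ x) (dot-zeros xs)) (+-identityˡ 0ℚ)

dot-++ : ∀ {m n} (a : Vec ℚ m) (b : Vec ℚ n) x y → dot (a ++ b) (x ++ y) ≡ dot a x + dot b y
dot-++ []       b []       y = ≡-sym (+-identityˡ (dot b y))
dot-++ (a ∷ as) b (x ∷ xs) y =
  trans (cong (λ z → a * x + z) (dot-++ as b xs y)) (≡-sym (+-assoc (a * x) (dot as xs) (dot b y)))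

dot-scale : ∀ {n} c (a x : Vec ℚ n) → dot (Vec.map (c *_) a) x ≡ c * dot a x
dot-scale c []       []       = ≡-sym (*-zeroʳ c)
dot-scale c (a ∷ as) (x ∷ xs) =
  trans (cong₂ _+_ (*-assoc c a x) (dot-scale c as xs)) (≡-sym (*-distribˡ-+ c (a * x) (dot as xs)))

identity : ∀ n → Vec (Vec ℚ n) n
identity zero    = []
identity (suc n) = (1ℚ ∷ zeros) ∷ Vec.map (0ℚ ∷_) (identity n)

dot-0∷ : ∀ {n} x (a y : Vec ℚ n) → dot (0ℚ ∷ a) (x ∷ y) ≡ dot a y
dot-0∷ x a y = trans (cong (_+ dot a y) (*-zeroˡ x)) (+-identityˡ (dot a y))

dot-∷zeros : ∀ {n} c x (y : Vec ℚ n) → dot (c ∷ zeros) (x ∷ y) ≡ c * x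
dot-∷zeros c x y = trans (cong (λ z → c * x + z) (dot-zeros y)) (+-identityʳ (c * x))

-- In the uses below `f` pads rows with zeros, so the padded matrix ignores the additional
-- coordinates.
·-map : ∀ {m n q} (f : Vec ℚ m → Vec ℚ n) {x : Vec ℚ n} {y : Vec ℚ m} →
  (∀ a → dot (f a) x ≡ dot a y) → (A : Vec (Vec ℚ m) q) → Vec.map f A · x ≡ A · y
·-map f f-dot A = trans (≡-sym (map-∘ _ f A)) (map-cong f-dot A)

identity-· : ∀ {n} (x : Vec ℚ n) → identity n · x ≡ x
identity-· []       = refl
identity-· (x ∷ xs) = cong₂ _∷_
  (trans (dot-∷zeros 1ℚ x xs) (*-identityˡ x))
  (trans (·-map (0ℚ ∷_) (λ a → dot-0∷ x a xs) (identity _)) (identity-· xs))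

plain : ∀ {p q} → Act → Vec (Vec ℚ p) q → FLayer p q
plain σ A = record { A = A ; b = zeros ; σ = σ }

eval-plain : ∀ {p q} σ (A : Vec (Vec ℚ p) q) x → evalFLayer (plain σ A) x ≡ Vec.map (act σ) (A · x)
eval-plain σ A x = cong (Vec.map (act σ)) (zipWith-identityʳ +-identityʳ (A · x))

eval-linear : ∀ {p q} (A : Vec (Vec ℚ p) q) x → evalFLayer (plain ident A) x ≡ A · x
eval-linear A x = trans (eval-plain ident A x) (map-id (A · x))

_⊙_ : ∀ {p q r} → FNN p q → FNN q r → FNN p r
M ⊙ layer L = M ▸ L
M ⊙ (N ▸ L) = (M ⊙ N) ▸ L

eval-⊙ : ∀ {p q r} (M : FNN p q) (N : FNN q r) x → evalFNN (M ⊙ N) x ≡ evalFNN N (evalFNN M x)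
eval-⊙ M (layer L) x = refl
eval-⊙ M (N ▸ L)   x = cong (evalFLayer L) (eval-⊙ M N x)

-- The carried coordinate x passes through a ReLU layer as the pair relu x, relu (- x).
carryRelu : ∀ {p q} → FLayer p q → FLayer (suc p) (suc (suc q))
carryRelu L = record
  { A = (1ℚ ∷ zeros) ∷ (- 1ℚ ∷ zeros) ∷ Vec.map (0ℚ ∷_) (A L)
  ; b = 0ℚ ∷ 0ℚ ∷ b L
  ; σ = relu
  }

recombine : ∀ q → Vec (Vec ℚ (suc (suc q))) (suc q)
recombine q = (1ℚ ∷ - 1ℚ ∷ zeros) ∷ Vec.map (λ a → 0ℚ ∷ 0ℚ ∷ a) (identity q)

carryIdent : ∀ {p q} → FLayer p q → FLayer (suc p) (suc q)
carryIdent L = record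
  { A = (1ℚ ∷ zeros) ∷ Vec.map (0ℚ ∷_) (A L)
  ; b = 0ℚ ∷ b L
  ; σ = ident
  }

-- The decomposition of `x` into positive and negative part, with signs written as the factors
-- `- 1ℚ` that the matrix rows produce.
relu-split : ∀ x → (0ℚ ⊔ x) + - 1ℚ * (0ℚ ⊔ (- 1ℚ * x)) ≡ x
relu-split x with ≤-total 0ℚ x
... | inj₁ 0≤x = begin
  (0ℚ ⊔ x) + - 1ℚ * (0ℚ ⊔ (- 1ℚ * x))  ≡⟨ cong₂ (λ u v → u + - 1ℚ * v) (p≤q⇒p⊔q≡q 0≤x) (p≥q⇒p⊔q≡p -x≤0) ⟩
  x + - 1ℚ * 0ℚ                       ≡⟨ cong (λ z → x + z) (*-zeroʳ (- 1ℚ)) ⟩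
  x + 0ℚ                              ≡⟨ +-identityʳ x ⟩
  x ∎
  where
  open ≡-Reasoning
  -x≤0 = *-monoˡ-≤-nonPos (- 1ℚ) 0≤x
... | inj₂ x≤0 = begin
  (0ℚ ⊔ x) + - 1ℚ * (0ℚ ⊔ (- 1ℚ * x))  ≡⟨ cong₂ (λ u v → u + - 1ℚ * v) (p≥q⇒p⊔q≡p x≤0) (p≤q⇒p⊔q≡q 0≤-x) ⟩
  0ℚ + - 1ℚ * (- 1ℚ * x)              ≡⟨ +-identityˡ _ ⟩
  - 1ℚ * (- 1ℚ * x)                   ≡⟨ ≡-sym (*-assoc (- 1ℚ) (- 1ℚ) x) ⟩
  (- 1ℚ * - 1ℚ) * x                   ≡⟨ *-identityˡ x ⟩
  x ∎
  where
  open ≡-Reasoning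
  0≤-x = *-monoˡ-≤-nonPos (- 1ℚ) x≤0

-- A layer applies one activation to all its coordinates, so a carried value would be clipped by
-- `relu`. It therefore travels as two nonnegative parts, and an additional linear layer reassembles
-- it; under `ident` a unit row suffices.
carryLayer : ∀ {p q} (L : FLayer p q) →
  Σ (FNN (suc p) (suc q)) λ N → ∀ y x → evalFNN N (y ∷ x) ≡ y ∷ evalFLayer L x
carryLayer L@record { σ = ident } = layer (carryIdent L) , λ y x → cong₂ _∷_
  (trans (+-identityʳ _) (trans (dot-∷zeros 1ℚ y x) (*-identityˡ y)))
  (cong (λ u → Vec.map (act ident) (zipWith _+_ u (b L))) (·-map (0ℚ ∷_) (λ a → dot-0∷ y a x) (A L)))
carryLayer {q = q} L@record { σ = relu } = layer (carryRelu L) ▸ plain ident (recombine q) , correct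
  where
  carried : ∀ c y {n} (x : Vec ℚ n) → act relu (dot (c ∷ zeros) (y ∷ x) + 0ℚ) ≡ 0ℚ ⊔ (c * y)
  carried c y x = cong (0ℚ ⊔_) (trans (+-identityʳ _) (dot-∷zeros c y x))

  correct : ∀ y x → evalFLayer (plain ident (recombine q)) (evalFLayer (carryRelu L) (y ∷ x))
                    ≡ y ∷ evalFLayer L x
  correct y x = begin
    evalFLayer (plain ident (recombine q)) (evalFLayer (carryRelu L) (y ∷ x))
      ≡⟨ cong (evalFLayer (plain ident (recombine q)))
           (cong₂ _∷_ (trans (carried 1ℚ y x) (cong (0ℚ ⊔_) (*-identityˡ y)))
             (cong₂ _∷_ (carried (- 1ℚ) y x)
               (cong (λ u → Vec.map (act relu) (zipWith _+_ u (b L)))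
                 (·-map (0ℚ ∷_) (λ a → dot-0∷ y a x) (A L))))) ⟩
    evalFLayer (plain ident (recombine q)) (u ∷ v ∷ evalFLayer L x)
      ≡⟨ eval-linear (recombine q) (u ∷ v ∷ evalFLayer L x) ⟩
    recombine q · (u ∷ v ∷ evalFLayer L x)
      ≡⟨ cong₂ _∷_
           (trans (cong₂ _+_ (*-identityˡ u) (dot-∷zeros (- 1ℚ) v (evalFLayer L x))) (relu-split y))
           (trans (·-map (λ a → 0ℚ ∷ 0ℚ ∷ a)
                    (λ a → trans (dot-0∷ u (0ℚ ∷ a) (v ∷ evalFLayer L x)) (dot-0∷ v a (evalFLayer L x)))
                    (identity q))
                  (identity-· (evalFLayer L x))) ⟩
    y ∷ evalFLayer L x ∎
    where
    open ≡-Reasoning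
    u = 0ℚ ⊔ y
    v = 0ℚ ⊔ (- 1ℚ * y)

carryOne : ∀ {p q} (N : FNN p q) →
  Σ (FNN (suc p) (suc q)) λ N′ → ∀ y x → evalFNN N′ (y ∷ x) ≡ y ∷ evalFNN N x
carryOne (layer L) = carryLayer L
carryOne (N ▸ L) with carryOne N | carryLayer L
... | N′ , N′-ok | L′ , L′-ok = N′ ⊙ L′ , λ y x →
  trans (eval-⊙ N′ L′ (y ∷ x)) (trans (cong (evalFNN L′) (N′-ok y x)) (L′-ok y (evalFNN N x)))

-- With this, networks of different depths and activations can run one after the other on separate
-- blocks, and parallel composition requires no alignment of their layers.
carry : ∀ m {p q} (N : FNN p q) →
  Σ (FNN (m ℕ.+ p) (m ℕ.+ q)) λ N′ → ∀ (y : Vec ℚ m) x → evalFNN N′ (y ++ x) ≡ y ++ evalFNN N x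
carry zero    N = N , λ { [] x → refl }
carry (suc m) N with carry m N
... | N′ , N′-ok with carryOne N′
... | N″ , N″-ok = N″ , λ { (y ∷ ys) x → trans (N″-ok y (ys ++ x)) (cong (y ∷_) (N′-ok ys x)) }

dropMatrix : ∀ p q → Vec (Vec ℚ (p ℕ.+ q)) q
dropMatrix p q = Vec.map (replicate p 0ℚ ++_) (identity q)

takeMatrix : ∀ p q → Vec (Vec ℚ (p ℕ.+ q)) p
takeMatrix p q = Vec.map (_++ replicate q 0ℚ) (identity p)

dropMatrix-· : ∀ {p q} (x : Vec ℚ p) (y : Vec ℚ q) → dropMatrix p q · (x ++ y) ≡ y
dropMatrix-· x y = trans
  (·-map (zeros ++_) (λ a → trans (dot-++ zeros a x y)
    (trans (cong (_+ dot a y) (dot-zeros x)) (+-identityˡ (dot a y)))) (identity _))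
  (identity-· y)

takeMatrix-· : ∀ {p q} (x : Vec ℚ p) (y : Vec ℚ q) → takeMatrix p q · (x ++ y) ≡ x
takeMatrix-· x y = trans
  (·-map (_++ zeros) (λ a → trans (dot-++ a zeros x y)
    (trans (cong (λ z → dot a x + z) (dot-zeros y)) (+-identityʳ (dot a x)))) (identity _))
  (identity-· x)

-- Closure properties of the functions realisable by ReLU networks.

zipWith-ext : ∀ {p} {u v : ℚ → ℚ → ℚ} → (∀ x y → u x y ≡ v x y) →
  (xs ys : Vec ℚ p) → zipWith u xs ys ≡ zipWith v xs ys
zipWith-ext u≡v []       []       = refl
zipWith-ext u≡v (x ∷ xs) (y ∷ ys) = cong₂ _∷_ (u≡v x y) (zipWith-ext u≡v xs ys)

⊔-via-relu : ∀ x y → x + (0ℚ ⊔ (y - x)) ≡ x ⊔ y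
⊔-via-relu x y = trans (mono-≤-distrib-⊔ (+-monoʳ-≤ x) 0ℚ (y - x))
  (cong₂ _⊔_ (+-identityʳ x) (solve 2 (λ x y → x :+ (y :+ (:- x)) := y) refl x y))

⊓-via-relu : ∀ x y → x - (0ℚ ⊔ (x - y)) ≡ x ⊓ y
⊓-via-relu x y = trans (antimono-≤-distrib-⊔ (λ p≤q → +-monoʳ-≤ x (neg-antimono-≤ p≤q)) 0ℚ (x - y))
  (cong₂ _⊓_ (+-identityʳ x) (solve 2 (λ x y → x :+ (:- (x :+ (:- y))) := y) refl x y))

zipWith-nest : ∀ {p} (h : ℚ → ℚ → ℚ) (k : ℚ → ℚ) (l : ℚ → ℚ → ℚ) (xs ys : Vec ℚ p) →
  zipWith h xs (Vec.map k (zipWith l xs ys)) ≡ zipWith (λ x y → h x (k (l x y))) xs ys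
zipWith-nest h k l []       []       = refl
zipWith-nest h k l (x ∷ xs) (y ∷ ys) = cong (_ ∷_) (zipWith-nest h k l xs ys)

zipWith-flip : ∀ {p} (l : ℚ → ℚ → ℚ) (xs ys : Vec ℚ p) →
  zipWith l ys xs ≡ zipWith (λ x y → l y x) xs ys
zipWith-flip l []       []       = refl
zipWith-flip l (x ∷ xs) (y ∷ ys) = cong (_ ∷_) (zipWith-flip l xs ys)

-- `S` may hold more than the network sees: for `comb′` its elements contain a whole function `m`,
-- of which `inp` shows only the samples on the net.
module Realisability {S : Set} {n : ℕ} (inp : S → Vec ℚ n) where

  Realisable : ∀ {q} → (S → Vec ℚ q) → Set
  Realisable {q} f = Σ (FNN n q) λ N → ∀ s → evalFNN N (inp s) ≡ f s

  resp : ∀ {q} {f g : S → Vec ℚ q} → (∀ s → f s ≡ g s) → Realisable f → Realisable g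
  resp f≡g (N , N-ok) = N , λ s → trans (N-ok s) (f≡g s)

  apply : ∀ {p q} {f : S → Vec ℚ p} (M : FNN p q) → Realisable f → Realisable (λ s → evalFNN M (f s))
  apply M (N , N-ok) = N ⊙ M , λ s → trans (eval-⊙ N M (inp s)) (cong (evalFNN M) (N-ok s))

  linear : ∀ {p q} {f : S → Vec ℚ p} (A : Vec (Vec ℚ p) q) → Realisable f → Realisable (λ s → A · f s)
  linear {f = f} A R = resp (λ s → eval-linear A (f s)) (apply (layer (plain ident A)) R)

  input : Realisable inp
  input = layer (plain ident (identity n)) , λ s →
    trans (eval-linear (identity n) (inp s)) (identity-· (inp s))

  const : ∀ {q} (c : Vec ℚ q) → Realisable (λ _ → c)
  const c = layer record { A = replicate _ zeros ; b = c ; σ = ident } , λ s →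
    trans (map-id _) (trans (cong (λ u → zipWith _+_ u c) (zero-rows _ (inp s)))
      (zipWith-identityˡ +-identityˡ c))
    where
    zero-rows : ∀ m {k} (x : Vec ℚ k) → replicate m zeros · x ≡ zeros
    zero-rows zero    x = refl
    zero-rows (suc m) x = cong₂ _∷_ (dot-zeros x) (zero-rows m x)

  ++-left : ∀ {p q} {f : S → Vec ℚ p} {g : S → Vec ℚ q} → Realisable (λ s → f s ++ g s) → Realisable f
  ++-left {p} {q} {f} {g} R = resp (λ s → takeMatrix-· (f s) (g s)) (linear (takeMatrix p q) R)

  ++-right : ∀ {p q} (f : S → Vec ℚ p) {g : S → Vec ℚ q} → Realisable (λ s → f s ++ g s) → Realisable g
  ++-right {p} {q} f {g} R = resp (λ s → dropMatrix-· (f s) (g s)) (linear (dropMatrix p q) R)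

  swap-++ : ∀ {p q} {f : S → Vec ℚ p} {g : S → Vec ℚ q} →
    Realisable (λ s → f s ++ g s) → Realisable (λ s → g s ++ f s)
  swap-++ {p} {q} {f} {g} R = resp
    (λ s → trans (map-++ _ (dropMatrix p q) (takeMatrix p q))
                 (cong₂ _++_ (dropMatrix-· (f s) (g s)) (takeMatrix-· (f s) (g s))))
    (linear (dropMatrix p q ++ takeMatrix p q) R)

  -- Duplicate the input, then transform each copy while carrying the other one along.
  pair : ∀ {p q} {f : S → Vec ℚ p} {g : S → Vec ℚ q} →
    Realisable f → Realisable g → Realisable (λ s → f s ++ g s)
  pair {f = f} (M , M-ok) (N , N-ok) =
    transformʳ N N-ok (swap-++ {f = inp} {g = f} (transformʳ M M-ok duplicate))
    where
    duplicate : Realisable (λ s → inp s ++ inp s)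
    duplicate = resp
      (λ s → trans (map-++ _ (identity n) (identity n))
                   (cong₂ _++_ (identity-· (inp s)) (identity-· (inp s))))
      (linear (identity n ++ identity n) input)

    transformʳ : ∀ {p q} {f : S → Vec ℚ p} {g : S → Vec ℚ q} (N : FNN n q) →
      (∀ s → evalFNN N (inp s) ≡ g s) → Realisable (λ s → f s ++ inp s) → Realisable (λ s → f s ++ g s)
    transformʳ {p} {f = f} N N-ok R with carry p N
    ... | N′ , N′-ok = resp (λ s → trans (N′-ok (f s) (inp s)) (cong (f s ++_) (N-ok s))) (apply N′ R)

  rectify : ∀ {p} {f : S → Vec ℚ p} → Realisable f → Realisable (λ s → Vec.map (0ℚ ⊔_) (f s))
  rectify {p} {f} R = resp
    (λ s → trans (eval-plain relu (identity p) (f s)) (cong (Vec.map (0ℚ ⊔_)) (identity-· (f s))))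
    (apply (layer (plain relu (identity p))) R)

  combine : ∀ {p} (α β : ℚ) {f g : S → Vec ℚ p} → Realisable f → Realisable g →
    Realisable (λ s → zipWith (λ x y → α * x + β * y) (f s) (g s))
  combine {p} α β {f} {g} Rf Rg =
    resp (λ s → correct (f s) (g s)) (linear (rows (identity p) (identity p)) (pair Rf Rg))
    where
    rows : ∀ {k l q} → Vec (Vec ℚ k) q → Vec (Vec ℚ l) q → Vec (Vec ℚ (k ℕ.+ l)) q
    rows = zipWith λ a b → Vec.map (α *_) a ++ Vec.map (β *_) b

    rows-· : ∀ {k l q} (A : Vec (Vec ℚ k) q) (B : Vec (Vec ℚ l) q) x y →
      rows A B · (x ++ y) ≡ zipWith (λ u v → α * u + β * v) (A · x) (B · y)
    rows-· []      []      x y = refl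
    rows-· (a ∷ A) (b ∷ B) x y = cong₂ _∷_
      (trans (dot-++ (Vec.map (α *_) a) (Vec.map (β *_) b) x y)
             (cong₂ _+_ (dot-scale α a x) (dot-scale β b y)))
      (rows-· A B x y)

    correct : ∀ x y → rows (identity p) (identity p) · (x ++ y) ≡ zipWith (λ u v → α * u + β * v) x y
    correct x y = trans (rows-· (identity p) (identity p) x y)
                        (cong₂ (zipWith λ u v → α * u + β * v) (identity-· x) (identity-· y))

  plus : ∀ {p} {f g : S → Vec ℚ p} → Realisable f → Realisable g →
    Realisable (λ s → zipWith _+_ (f s) (g s))
  plus {f = f} {g} Rf Rg = resp
    (λ s → zipWith-ext (λ x y → cong₂ _+_ (*-identityˡ x) (*-identityˡ y)) (f s) (g s))
    (combine 1ℚ 1ℚ Rf Rg)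

  minus : ∀ {p} {f g : S → Vec ℚ p} → Realisable f → Realisable g →
    Realisable (λ s → zipWith _-_ (f s) (g s))
  minus {f = f} {g} Rf Rg = resp
    (λ s → zipWith-ext (λ x y → cong₂ _+_ (*-identityˡ x) (neg-one y)) (f s) (g s))
    (combine 1ℚ (- 1ℚ) Rf Rg)
    where
    neg-one : ∀ y → - 1ℚ * y ≡ - y
    neg-one y = trans (≡-sym (neg-distribˡ-* 1ℚ y)) (cong -_ (*-identityˡ y))

  maximum : ∀ {p} {f g : S → Vec ℚ p} → Realisable f → Realisable g →
    Realisable (λ s → zipWith _⊔_ (f s) (g s))
  maximum {f = f} {g} Rf Rg = resp
    (λ s → trans (cong (λ u → zipWith _+_ (f s) (Vec.map (0ℚ ⊔_) u)) (zipWith-flip _-_ (f s) (g s)))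
          (trans (zipWith-nest _+_ (0ℚ ⊔_) (λ x y → y - x) (f s) (g s))
                 (zipWith-ext ⊔-via-relu (f s) (g s))))
    (plus Rf (rectify (minus Rg Rf)))

  minimum : ∀ {p} {f g : S → Vec ℚ p} → Realisable f → Realisable g →
    Realisable (λ s → zipWith _⊓_ (f s) (g s))
  minimum {f = f} {g} Rf Rg = resp
    (λ s → trans (zipWith-nest _-_ (0ℚ ⊔_) _-_ (f s) (g s)) (zipWith-ext ⊓-via-relu (f s) (g s)))
    (minus Rf (rectify (minus Rf Rg)))

  replicated : ∀ m {t : S → ℚ} → Realisable (λ s → t s ∷ []) → Realisable (λ s → replicate m (t s))
  replicated zero    R = const []
  replicated (suc m) R = pair R (replicated m R)

  scaled : ∀ c {t : S → ℚ} → Realisable (λ s → t s ∷ []) → Realisable (λ s → c * t s ∷ [])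
  scaled c {t} R = resp (λ s → cong (_∷ []) (+-identityʳ (c * t s))) (linear ((c ∷ []) ∷ []) R)

-- Natural numbers in the rationals and the Archimedean property.

fromℚᵘ-homo-+ : ∀ x y → fromℚᵘ x + fromℚᵘ y ≡ fromℚᵘ (x ℚᵘ.+ y)
fromℚᵘ-homo-+ x y = toℚᵘ-injective (ℚᵘ.≃-trans (toℚᵘ-homo-+ (fromℚᵘ x) (fromℚᵘ y))
  (ℚᵘ.≃-trans (ℚᵘ.+-cong (toℚᵘ-fromℚᵘ x) (toℚᵘ-fromℚᵘ y)) (ℚᵘ.≃-sym (toℚᵘ-fromℚᵘ (x ℚᵘ.+ y)))))

fromℚᵘ-homo-* : ∀ x y → fromℚᵘ x * fromℚᵘ y ≡ fromℚᵘ (x ℚᵘ.* y)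
fromℚᵘ-homo-* x y = toℚᵘ-injective (ℚᵘ.≃-trans (toℚᵘ-homo-* (fromℚᵘ x) (fromℚᵘ y))
  (ℚᵘ.≃-trans (ℚᵘ.*-cong (toℚᵘ-fromℚᵘ x) (toℚᵘ-fromℚᵘ y)) (ℚᵘ.≃-sym (toℚᵘ-fromℚᵘ (x ℚᵘ.* y)))))

fromℕ : ℕ → ℚ
fromℕ zero    = 0ℚ
fromℕ (suc k) = 1ℚ + fromℕ k

fromℕ≡/1 : ∀ k → fromℕ k ≡ + k / 1
fromℕ≡/1 zero    = refl
fromℕ≡/1 (suc k) = trans (cong (λ z → 1ℚ + z) (fromℕ≡/1 k))
  (trans (fromℚᵘ-homo-+ (mkℚᵘ (+ 1) 0) (mkℚᵘ (+ k) 0))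
         (fromℚᵘ-cong {mkℚᵘ (+ 1) 0 ℚᵘ.+ mkℚᵘ (+ k) 0} {mkℚᵘ (+ suc k) 0}
           (*≡* (cong (λ z → (+ 1 ℤ.+ z) ℤ.* + 1) (ℤ.*-identityʳ (+ k))))))

1/suc : ℕ → ℚ
1/suc k = + 1 / suc k

1/suc>0 : ∀ k → 0ℚ < 1/suc k
1/suc>0 k = positive⁻¹ (1/suc k) {{normalize-pos 1 (suc k)}}

1/suc-inverse : ∀ k → 1/suc k * fromℕ (suc k) ≡ 1ℚ
1/suc-inverse k = trans (cong (λ z → 1/suc k * z) (fromℕ≡/1 (suc k)))
  (trans (fromℚᵘ-homo-* (mkℚᵘ (+ 1) k) (mkℚᵘ (+ suc k) 0))
         (fromℚᵘ-cong {mkℚᵘ (+ 1) k ℚᵘ.* mkℚᵘ (+ suc k) 0} {mkℚᵘ (+ 1) 0}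
           (*≡* (trans (ℤ.*-identityʳ _) (cong (λ z → + 1 ℤ.* z) (≡-sym (ℤ.*-identityʳ (+ suc k))))))))

-- A reduced fraction is at most the absolute value of its numerator, since its denominator is at
-- least 1.
≤fromℕ : ∀ x → ∃ λ k → x ≤ fromℕ k
≤fromℕ x@(mkℚ num den _) = ℤ.∣ num ∣ , subst (x ≤_) (≡-sym (fromℕ≡/1 ℤ.∣ num ∣))
  (toℚᵘ-cancel-≤ (ℚᵘ.≤-trans (*≤* numerators)
    (ℚᵘ.≤-reflexive (ℚᵘ.≃-sym (toℚᵘ-fromℚᵘ (mkℚᵘ (+ ℤ.∣ num ∣) 0))))))
  where
  i≤∣i∣ : ∀ i → i ℤ.≤ + ℤ.∣ i ∣
  i≤∣i∣ (+ k)        = ℤ.≤-refl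
  i≤∣i∣ ℤ.-[1+ k ]   = ℤ.-≤+
  numerators : num ℤ.* + 1 ℤ.≤ + ℤ.∣ num ∣ ℤ.* + suc den
  numerators = ℤ.≤-trans (ℤ.≤-reflexive (ℤ.*-identityʳ num)) (ℤ.≤-trans (i≤∣i∣ num)
    (subst (ℤ._≤ + ℤ.∣ num ∣ ℤ.* + suc den) (ℤ.*-identityʳ (+ ℤ.∣ num ∣))
      (ℤ.*-monoˡ-≤-nonNeg (+ ℤ.∣ num ∣) (ℤ.+≤+ (ℕ.s≤s ℕ.z≤n)))))

archimedean : ∀ x {ε} → 0ℚ < ε → ∃ λ k → x ≤ fromℕ k * ε
archimedean x {ε} 0<ε with ≤fromℕ (x * (1/ ε) {{pos⇒nonZero ε {{positive 0<ε}}}})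
... | k , x/ε≤k = k , subst (_≤ fromℕ k * ε)
  (trans (*-assoc x _ ε) (trans (cong (x *_) (*-inverseˡ ε {{pos⇒nonZero ε {{positive 0<ε}}}}))
    (*-identityʳ x)))
  (*-monoˡ _ (fromℕ k) ε (<⇒≤ 0<ε) x/ε≤k)

-- Dividing `ε` by `K` is avoided, as `K` may be zero: if `K ≤ k * ε`, then `δ` = 1/(k + 1) works,
-- the successor keeping the denominator nonzero.
shrink : ∀ K {ε} → 0ℚ < ε → Σ ℚ λ δ → 0ℚ < δ × K * δ ≤ ε
shrink K {ε} 0<ε with archimedean K 0<ε
... | k , K≤kε = δ , 1/suc>0 k , (begin
  K * δ                   ≤⟨ *-monoˡ K (fromℕ (suc k) * ε) δ (<⇒≤ (1/suc>0 k))
                               (≤-trans K≤kε (*-monoˡ (fromℕ k) (fromℕ (suc k)) ε (<⇒≤ 0<ε)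
                                 (q≤p+q (nonNegative⁻¹ 1ℚ)))) ⟩
  fromℕ (suc k) * ε * δ   ≡⟨ solve 3 (λ n e d → n :* e :* d := d :* n :* e) refl (fromℕ (suc k)) ε δ ⟩
  δ * fromℕ (suc k) * ε   ≡⟨ cong (_* ε) (1/suc-inverse k) ⟩
  1ℚ * ε                  ≡⟨ *-identityˡ ε ⟩
  ε ∎)
  where
  open ≤-Reasoning
  δ = 1/suc k

-- The properties of `MAX` and `MEAN` that the simulation uses.

-- `nonexpansive` controls errors independently of the degree; together with `preserves-zeros` it
-- turns bounds on messages into bounds on aggregates; `preserves-++` lets one message transport
-- many independent ones.
record WellBehaved (a : Agg) : Set₁ where
  field
    nonexpansive : ∀ {W : Set} {r ε} {f g : W → Vec ℚ r} → 0ℚ ≤ ε → (∀ w → f w ≋[ ε ] g w) →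
      ∀ ws → aggregate a (List.map f ws) ≋[ ε ] aggregate a (List.map g ws)
    preserves-zeros : ∀ {W : Set} {r} (ws : List W) → aggregate a (List.map (λ _ → zeros {r}) ws) ≡ zeros
    preserves-++ : ∀ {W : Set} {r s} (f : W → Vec ℚ r) (g : W → Vec ℚ s) ws →
      aggregate a (List.map (λ w → f w ++ g w) ws)
      ≡ aggregate a (List.map f ws) ++ aggregate a (List.map g ws)

zeros-++ : ∀ r {s} → zeros {r ℕ.+ s} ≡ zeros {r} ++ zeros {s}
zeros-++ zero    = refl
zeros-++ (suc r) = cong (0ℚ ∷_) (zeros-++ r)

-- The start value is a separate argument because `MAX` folds from its first message, which stays
-- fixed during induction on the others.
foldr-⊔ : ∀ {W : Set} {r} → (W → Vec ℚ r) → Vec ℚ r → List W → Vec ℚ r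
foldr-⊔ f x ws = List.foldr (zipWith _⊔_) x (List.map f ws)

zipWith-⊔-≋ : ∀ {r ε} {x x′ y y′ : Vec ℚ r} → x ≋[ ε ] x′ → y ≋[ ε ] y′ →
  zipWith _⊔_ x y ≋[ ε ] zipWith _⊔_ x′ y′
zipWith-⊔-≋ = PW.zipWith-cong ≈-⊔

max-wellBehaved : WellBehaved MAX
max-wellBehaved = record
  { nonexpansive = λ { 0≤ε f≋g [] → ≋-refl 0≤ε ; 0≤ε f≋g (w ∷ ws) → fold-≋ f≋g (f≋g w) ws }
  ; preserves-zeros = λ { [] → refl ; (w ∷ ws) → fold-zeros ws }
  ; preserves-++ = λ { {r = r} f g [] → zeros-++ r ; f g (w ∷ ws) → fold-++ f g (f w) (g w) ws }
  }
  where
  fold-≋ : ∀ {W : Set} {r ε} {f g : W → Vec ℚ r} {x y} → (∀ w → f w ≋[ ε ] g w) → x ≋[ ε ] y →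
    ∀ ws → foldr-⊔ f x ws ≋[ ε ] foldr-⊔ g y ws
  fold-≋ f≋g x≋y []       = x≋y
  fold-≋ f≋g x≋y (w ∷ ws) = zipWith-⊔-≋ (f≋g w) (fold-≋ f≋g x≋y ws)

  fold-zeros : ∀ {W : Set} {r} (ws : List W) → foldr-⊔ (λ _ → zeros {r}) zeros ws ≡ zeros
  fold-zeros []       = refl
  fold-zeros (w ∷ ws) = trans (cong (zipWith _⊔_ zeros) (fold-zeros ws)) (zipWith-replicate _⊔_ 0ℚ 0ℚ)

  fold-++ : ∀ {W : Set} {r s} (f : W → Vec ℚ r) (g : W → Vec ℚ s) x y ws →
    foldr-⊔ (λ w → f w ++ g w) (x ++ y) ws ≡ foldr-⊔ f x ws ++ foldr-⊔ g y ws
  fold-++ f g x y []       = refl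
  fold-++ f g x y (w ∷ ws) = trans (cong (zipWith _⊔_ (f w ++ g w)) (fold-++ f g x y ws))
    (zipWith-++ _⊔_ (f w) (g w) (foldr-⊔ f x ws) (foldr-⊔ g y ws))

sum-of : ∀ {W : Set} {r} → (W → Vec ℚ r) → List W → Vec ℚ r
sum-of f ws = vsum (List.map f ws)

-- Counting `ws` in place of the mapped list makes the factor independent of `f`, so that means of
-- different message functions can be compared.
mean-∷ : ∀ {W : Set} {r} (f : W → Vec ℚ r) w ws →
  aggregate MEAN (List.map f (w ∷ ws)) ≡ Vec.map (1/suc (length ws) *_) (sum-of f (w ∷ ws))
mean-∷ f w ws = cong (λ k → Vec.map (1/suc k *_) (sum-of f (w ∷ ws))) (List.length-map f ws)

mean-wellBehaved : WellBehaved MEAN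
mean-wellBehaved = record
  { nonexpansive = λ { 0≤ε f≋g [] → ≋-refl 0≤ε ; 0≤ε f≋g (w ∷ ws) → mean-≋ 0≤ε f≋g w ws }
  ; preserves-zeros = λ { [] → refl ; (w ∷ ws) → mean-zeros w ws }
  ; preserves-++ = λ { {r = r} f g [] → zeros-++ r ; f g (w ∷ ws) → mean-++ f g w ws }
  }
  where
  sum-≋ : ∀ {W : Set} {r ε} {f g : W → Vec ℚ r} → (∀ w → f w ≋[ ε ] g w) →
    ∀ ws → sum-of f ws ≋[ fromℕ (length ws) * ε ] sum-of g ws
  sum-≋ {ε = ε} f≋g [] = ≋-refl (≤-reflexive (≡-sym (*-zeroˡ ε)))
  sum-≋ {ε = ε} {f} {g} f≋g (w ∷ ws) = subst (sum-of f (w ∷ ws) ≋[_] sum-of g (w ∷ ws))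
    (solve 2 (λ e k → e :+ k :* e := (con 1ℚ :+ k) :* e) refl ε (fromℕ (length ws)))
    (zipWith-+-≋ (f≋g w) (sum-≋ f≋g ws))
    where
    zipWith-+-≋ : ∀ {r ε δ} {x x′ y y′ : Vec ℚ r} → x ≋[ ε ] x′ → y ≋[ δ ] y′ →
      zipWith _+_ x y ≋[ ε + δ ] zipWith _+_ x′ y′
    zipWith-+-≋ []         []         = []
    zipWith-+-≋ (x≈ ∷ xs≈) (y≈ ∷ ys≈) = ≈-+ x≈ y≈ ∷ zipWith-+-≋ xs≈ ys≈

  mean-≋ : ∀ {W : Set} {r ε} {f g : W → Vec ℚ r} → 0ℚ ≤ ε → (∀ w → f w ≋[ ε ] g w) →
    ∀ w ws → aggregate MEAN (List.map f (w ∷ ws)) ≋[ ε ] aggregate MEAN (List.map g (w ∷ ws))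
  mean-≋ {r = r} {ε} {f} {g} 0≤ε f≋g w ws =
    subst₂ _≋[ ε ]_ (≡-sym (mean-∷ f w ws)) (≡-sym (mean-∷ g w ws))
      -- The factor `c` cancels the number of summands by which `sum-≋` multiplied the error.
      (subst (Vec.map (c *_) (sum-of f (w ∷ ws)) ≋[_] Vec.map (c *_) (sum-of g (w ∷ ws)))
        (trans (≡-sym (*-assoc c (fromℕ (suc (length ws))) ε))
          (trans (cong (_* ε) (1/suc-inverse (length ws))) (*-identityˡ ε)))
        (PW.map⁺ (≈-scale (<⇒≤ (1/suc>0 (length ws)))) (sum-≋ f≋g (w ∷ ws))))
    where c = 1/suc (length ws)

  sum-zeros : ∀ {W : Set} {r} (ws : List W) → sum-of (λ _ → zeros {r}) ws ≡ zeros
  sum-zeros []       = refl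
  sum-zeros (w ∷ ws) = trans (zipWith-identityˡ +-identityˡ _) (sum-zeros ws)

  mean-zeros : ∀ {W : Set} {r} (w : W) ws → aggregate MEAN (List.map (λ _ → zeros {r}) (w ∷ ws)) ≡ zeros
  mean-zeros {r = r} w ws = trans (mean-∷ (λ _ → zeros) w ws)
    (trans (cong (Vec.map (1/suc (length ws) *_)) (sum-zeros (w ∷ ws)))
      (trans (map-replicate (1/suc (length ws) *_) 0ℚ r)
        (cong (Vec.replicate r) (*-zeroʳ (1/suc (length ws))))))

  sum-++ : ∀ {W : Set} {r s} (f : W → Vec ℚ r) (g : W → Vec ℚ s) ws →
    sum-of (λ w → f w ++ g w) ws ≡ sum-of f ws ++ sum-of g ws
  sum-++ {r = r} f g [] = zeros-++ r
  sum-++ f g (w ∷ ws) = trans (cong (zipWith _+_ (f w ++ g w)) (sum-++ f g ws))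
    (zipWith-++ _+_ (f w) (g w) (sum-of f ws) (sum-of g ws))

  mean-++ : ∀ {W : Set} {r s} (f : W → Vec ℚ r) (g : W → Vec ℚ s) w ws →
    aggregate MEAN (List.map (λ w → f w ++ g w) (w ∷ ws))
    ≡ aggregate MEAN (List.map f (w ∷ ws)) ++ aggregate MEAN (List.map g (w ∷ ws))
  mean-++ f g w ws = trans (mean-∷ (λ w → f w ++ g w) w ws)
    (trans (cong (Vec.map (c *_)) (sum-++ f g (w ∷ ws)))
      (trans (map-++ (c *_) (sum-of f (w ∷ ws)) (sum-of g (w ∷ ws)))
        (≡-sym (cong₂ _++_ (mean-∷ f w ws) (mean-∷ g w ws)))))
    where c = 1/suc (length ws)

-- Sup distance, finite nets and interpolation of Lipschitz functions.

dist : ∀ {p} → Vec ℚ p → Vec ℚ p → ℚ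
dist []       []       = 0ℚ
dist (x ∷ xs) (y ∷ ys) = ((x - y) ⊔ (y - x)) ⊔ dist xs ys

dist≥0 : ∀ {p} (x y : Vec ℚ p) → 0ℚ ≤ dist x y
dist≥0 []       []       = ≤-refl
dist≥0 (x ∷ xs) (y ∷ ys) = ≤-trans (dist≥0 xs ys) (p≤q⊔p ((x - y) ⊔ (y - x)) (dist xs ys))

p≤q+⇒p-q≤ : ∀ p q r → p ≤ q + r → p - q ≤ r
p≤q+⇒p-q≤ p q r p≤q+r = subst (p - q ≤_)
  (solve 2 (λ q r → (q :+ r) :+ (:- q) := r) refl q r) (+-monoˡ-≤ (- q) p≤q+r)

p-q≤⇒p≤q+ : ∀ p q r → p - q ≤ r → p ≤ q + r
p-q≤⇒p≤q+ p q r p-q≤r = subst (_≤ q + r)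
  (solve 2 (λ p q → q :+ (p :+ (:- q)) := p) refl p q) (+-monoʳ-≤ q p-q≤r)

≋-dist : ∀ {p} (x y : Vec ℚ p) → x ≋[ dist x y ] y
≋-dist []       []       = []
≋-dist (x ∷ xs) (y ∷ ys) =
  (p-q≤⇒p≤q+ x y _ (≤-trans (p≤p⊔q (x - y) (y - x)) (p≤p⊔q ∣x-y∣ (dist xs ys)))
   , p-q≤⇒p≤q+ y x _ (≤-trans (p≤q⊔p (x - y) (y - x)) (p≤p⊔q ∣x-y∣ (dist xs ys))))
  ∷ ≋-weaken (p≤q⊔p ∣x-y∣ (dist xs ys)) (≋-dist xs ys)
  where ∣x-y∣ = (x - y) ⊔ (y - x)

dist-least : ∀ {p δ} {x y : Vec ℚ p} → 0ℚ ≤ δ → x ≋[ δ ] y → dist x y ≤ δ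
dist-least 0≤δ []         = 0≤δ
dist-least {x = x ∷ _} {y ∷ _} 0≤δ ((x≤y , y≤x) ∷ xs≈ys) =
  ⊔-lub (⊔-lub (p≤q+⇒p-q≤ x y _ x≤y) (p≤q+⇒p-q≤ y x _ y≤x)) (dist-least 0≤δ xs≈ys)

arithmetic : ℚ → ℚ → ℕ → List ℚ
arithmetic a δ zero    = a ∷ []
arithmetic a δ (suc k) = a ∷ arithmetic (a + δ) δ k

arithmetic-covers : ∀ {x δ} a k → 0ℚ ≤ δ → a ≤ x → x ≤ a + fromℕ k * δ →
  Any (x ≈[ δ ]_) (arithmetic a δ k)
arithmetic-covers {x} {δ} a zero 0≤δ a≤x x≤a =
  here (≤-trans x≤a (+-monoʳ-≤ a (subst (_≤ δ) (≡-sym (*-zeroˡ δ)) 0≤δ)) , ≤-trans a≤x (p≤p+q 0≤δ))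
arithmetic-covers {x} {δ} a (suc k) 0≤δ a≤x x≤end with ≤-total x (a + δ)
... | inj₁ x≤a+δ = here (x≤a+δ , ≤-trans a≤x (p≤p+q 0≤δ))
... | inj₂ a+δ≤x = there (arithmetic-covers (a + δ) k 0≤δ a+δ≤x (subst (x ≤_)
  (solve 3 (λ a d k → a :+ (con 1ℚ :+ k) :* d := (a :+ d) :+ k :* d) refl a δ (fromℕ k)) x≤end))

-- In the sup norm a product of one-dimensional δ-nets is a δ-net with the same δ. Each line starts
-- at `- M` and takes enough steps to cover the length `M + M`.
net : ∀ p M {δ} → 0ℚ < δ → Σ (List (Vec ℚ p)) λ cs → ∀ {x} → Bounded M x → Any (x ≋[ δ ]_) cs
net zero    M 0<δ = [] ∷ [] , λ { [] → here [] }
net (suc p) M {δ} 0<δ with archimedean (M + M) 0<δ | net p M 0<δ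
... | k , 2M≤kδ | cs , cs-cover = cartesianProductWith _∷_ line cs , λ
  { (x≈0 ∷ xs≈0) → cartesianProductWith⁺ _∷_ _∷_ (line-cover x≈0) (cs-cover xs≈0) }
  where
  line = arithmetic (- M) δ k
  line-cover : ∀ {x} → 0ℚ ≈[ M ] x → Any (x ≈[ δ ]_) line
  line-cover {x} (0≤x+M , x≤0+M) = arithmetic-covers (- M) k (<⇒≤ 0<δ)
    (subst₂ _≤_ (+-identityˡ (- M)) (solve 2 (λ x M → x :+ M :+ (:- M) := x) refl x M)
      (+-monoˡ-≤ (- M) 0≤x+M))
    (≤-trans x≤0+M (subst (_≤ - M + fromℕ k * δ)
      (solve 1 (λ M → (:- M) :+ (M :+ M) := con 0ℚ :+ M) refl M) (+-monoʳ-≤ (- M) 2M≤kδ)))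

-- McShane's extension: the pointwise minimum of the cones m c + K dist x c over the net reproduces
-- a K-Lipschitz m up to 2Kδ, using neither a product nor a case distinction on x.
envelope : ∀ {p r} → ℚ → ℚ → (Vec ℚ p → Vec ℚ r) → List (Vec ℚ p) → Vec ℚ p → Vec ℚ r
envelope K B m []       x = replicate _ B
envelope K B m (c ∷ cs) x =
  zipWith _⊓_ (zipWith _+_ (m c) (replicate _ (K * dist x c))) (envelope K B m cs x)

_≤ᵥ[_]_ : ∀ {n} → Vec ℚ n → ℚ → Vec ℚ n → Set
x ≤ᵥ[ ε ] y = Pointwise (λ a b → a ≤ b + ε) x y

module _ {p r} {K B : ℚ} {m : Vec ℚ p → Vec ℚ r} {x : Vec ℚ p}
         (m-lipschitz : ∀ c → m x ≋[ K * dist x c ] m c) where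

  -- Each cone lies above `m x` by the Lipschitz bound. The final constant `B` does so because it
  -- bounds `m x`, and thus it can start the minimum without spoiling it.
  below-envelope : Bounded B (m x) → ∀ cs → Pointwise _≤_ (m x) (envelope K B m cs x)
  below-envelope B-mx [] = below-constant B-mx
    where
    below-constant : ∀ {n} {y : Vec ℚ n} → Bounded B y → Pointwise _≤_ y (replicate n B)
    below-constant []                           = []
    below-constant {y = y ∷ _} (y≈0 ∷ ys≈0) =
      subst (y ≤_) (+-identityˡ B) (lower y≈0) ∷ below-constant ys≈0
  below-envelope B-mx (c ∷ cs) = below-⊓ (below-cone (m-lipschitz c)) (below-envelope B-mx cs)
    where
    below-cone : ∀ {n t} {y z : Vec ℚ n} → y ≋[ t ] z → Pointwise _≤_ y (zipWith _+_ z (replicate n t))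
    below-cone []            = []
    below-cone (y≈z ∷ ys≈zs) = upper y≈z ∷ below-cone ys≈zs

    below-⊓ : ∀ {n} {y u v : Vec ℚ n} → Pointwise _≤_ y u → Pointwise _≤_ y v →
      Pointwise _≤_ y (zipWith _⊓_ u v)
    below-⊓ []           []           = []
    below-⊓ (y≤u ∷ ys≤us) (y≤v ∷ ys≤vs) = ⊓-glb y≤u y≤v ∷ below-⊓ ys≤us ys≤vs

  -- A single close net point `c` suffices, as a minimum only decreases with further cones. Its cone
  -- exceeds `m x` by at most `K * dist x c` for passing from `m x` to `m c` and as much again for
  -- the slope.
  envelope-near : ∀ {δ cs} → 0ℚ ≤ K → 0ℚ ≤ δ → Any (x ≋[ δ ]_) cs →
    envelope K B m cs x ≤ᵥ[ (K + K) * δ ] m x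
  envelope-near {δ} {c ∷ cs} 0≤K 0≤δ (here x≈c) =
    ⊓-leftᵥ (cone-near (m-lipschitz c)) (envelope K B m cs x)
    where
    t = K * dist x c

    2t≤ : t + t ≤ (K + K) * δ
    2t≤ = subst (_≤ (K + K) * δ) (*-distribʳ-+ (dist x c) K K)
      (*-monoʳ (+-nonneg 0≤K 0≤K) (dist-least 0≤δ x≈c))

    cone-near : ∀ {n} {y z : Vec ℚ n} → y ≋[ t ] z → zipWith _+_ z (replicate n t) ≤ᵥ[ (K + K) * δ ] y
    cone-near []            = []
    cone-near {y = y ∷ _} {z ∷ _} (y≈z ∷ ys≈zs) =
      ≤-trans (+-monoˡ-≤ t (lower y≈z)) (subst (_≤ y + (K + K) * δ) (≡-sym (+-assoc y t t))
        (+-monoʳ-≤ y 2t≤))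
      ∷ cone-near ys≈zs

    ⊓-leftᵥ : ∀ {n η} {u y : Vec ℚ n} → u ≤ᵥ[ η ] y → ∀ v → zipWith _⊓_ u v ≤ᵥ[ η ] y
    ⊓-leftᵥ []             []       = []
    ⊓-leftᵥ {u = u ∷ _} (u≤y ∷ us≤ys) (v ∷ vs) = ≤-trans (p⊓q≤p u v) u≤y ∷ ⊓-leftᵥ us≤ys vs
  envelope-near {δ} {c ∷ cs} 0≤K 0≤δ (there x≈cs) =
    ⊓-rightᵥ (zipWith _+_ (m c) (replicate _ (K * dist x c))) (envelope-near 0≤K 0≤δ x≈cs)
    where
    ⊓-rightᵥ : ∀ {n η} {v y : Vec ℚ n} u → v ≤ᵥ[ η ] y → zipWith _⊓_ u v ≤ᵥ[ η ] y
    ⊓-rightᵥ []       []             = []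
    ⊓-rightᵥ {v = v ∷ _} (u ∷ us) (v≤y ∷ vs≤ys) = ≤-trans (p⊓q≤q u v) v≤y ∷ ⊓-rightᵥ us vs≤ys

  envelope-approximates : ∀ {δ cs} → 0ℚ ≤ K → 0ℚ ≤ δ → Bounded B (m x) → Any (x ≋[ δ ]_) cs →
    m x ≋[ (K + K) * δ ] envelope K B m cs x
  envelope-approximates {δ} {cs} 0≤K 0≤δ B-mx x≈cs =
    within (below-envelope B-mx cs) (envelope-near 0≤K 0≤δ x≈cs)
    where
    within : ∀ {n} {y e : Vec ℚ n} → Pointwise _≤_ y e → e ≤ᵥ[ (K + K) * δ ] y → y ≋[ (K + K) * δ ] e
    within []            []            = []
    within (y≤e ∷ ys≤es) (e≤y ∷ es≤ys) =
      (≤-trans y≤e (p≤p+q (*-nonneg (+-nonneg 0≤K 0≤K) 0≤δ)) , e≤y) ∷ within ys≤es es≤ys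

-- Computing the envelope from finitely many aggregated samples.

samples : ∀ {p r} → (Vec ℚ p → Vec ℚ r) → (cs : List (Vec ℚ p)) → Vec ℚ (length cs ℕ.* r)
samples m []       = []
samples m (c ∷ cs) = m c ++ samples m cs

module _ {S : Set} {n : ℕ} {inp : S → Vec ℚ n} where
  open Realisability inp

  η-∷ : ∀ {k} (x : Vec ℚ (suc k)) → x ≡ (Vec.head x ∷ []) ++ Vec.tail x
  η-∷ (x ∷ xs) = refl

  dist-realisable : ∀ {p} {f : S → Vec ℚ p} → Realisable f → ∀ c → Realisable (λ s → dist (f s) c ∷ [])
  dist-realisable {f = f} R [] = resp (λ s → dist-[] (f s)) (const (0ℚ ∷ []))
    where
    dist-[] : ∀ x → 0ℚ ∷ [] ≡ dist x [] ∷ []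
    dist-[] [] = refl
  dist-realisable {f = f} R (c ∷ cs) = resp (λ s → dist-∷ (f s))
    (maximum (maximum (minus first (const (c ∷ []))) (minus (const (c ∷ [])) first))
             (dist-realisable rest cs))
    where
    split : Realisable (λ s → (Vec.head (f s) ∷ []) ++ Vec.tail (f s))
    split = resp (λ s → η-∷ (f s)) R
    first : Realisable (λ s → Vec.head (f s) ∷ [])
    first = ++-left {f = λ s → Vec.head (f s) ∷ []} {g = λ s → Vec.tail (f s)} split
    rest : Realisable (λ s → Vec.tail (f s))
    rest = ++-right (λ s → Vec.head (f s) ∷ []) split
    dist-∷ : ∀ x → (((Vec.head x - c) ⊔ (c - Vec.head x)) ⊔ dist (Vec.tail x) cs) ∷ []
             ≡ dist x (c ∷ cs) ∷ []
    dist-∷ (x ∷ xs) = refl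

  -- `K`, `B` and the net are weights of the network, while `f s` and the samples of `m s` are its
  -- data; every product thus has a constant factor.
  envelope-realisable : ∀ {p r} K B {m : S → Vec ℚ p → Vec ℚ r} {f : S → Vec ℚ p} → Realisable f →
    ∀ cs → Realisable (λ s → samples (m s) cs) → Realisable (λ s → envelope K B (m s) cs (f s))
  envelope-realisable K B Rf []       Rm = const (replicate _ B)
  envelope-realisable K B {m} Rf (c ∷ cs) Rm = minimum
    (plus (++-left {f = λ s → m s c} {g = λ s → samples (m s) cs} Rm)
          (replicated _ (scaled K (dist-realisable Rf c))))
    (envelope-realisable K B Rf cs (++-right (λ s → m s c) Rm))

  samples-realisable : ∀ {p r} (m : S → Vec ℚ p → Vec ℚ r) cs → (∀ c → Realisable (λ s → m s c)) →
    Realisable (λ s → samples (m s) cs)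
  samples-realisable m []       Rm = const []
  samples-realisable m (c ∷ cs) Rm = pair (Rm c) (samples-realisable m cs Rm)

-- Aggregation acts blockwise, so a single round of messages delivers the aggregate for every net
-- point.
aggregate-samples : ∀ {a} → WellBehaved a →
  ∀ {W : Set} {p r} (m : W → Vec ℚ p → Vec ℚ r) cs (ws : List W) →
  aggregate a (List.map (λ w → samples (m w) cs) ws)
  ≡ samples (λ c → aggregate a (List.map (λ w → m w c) ws)) cs
aggregate-samples {a} wb m [] ws = empty _
  where
  empty : (x : Vec ℚ 0) → x ≡ []
  empty [] = refl
aggregate-samples {a} wb m (c ∷ cs) ws =
  trans (WellBehaved.preserves-++ wb (λ w → m w c) (λ w → samples (m w) cs) ws)
        (cong (aggregate a (List.map (λ w → m w c) ws) ++_) (aggregate-samples wb m cs ws))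

Bounded-++ : ∀ {m k M} {x : Vec ℚ m} {y : Vec ℚ k} → Bounded M x → Bounded M y → Bounded M (x ++ y)
Bounded-++ {m} {M = M} {x} {y} M-x M-y = subst (_≋[ M ] x ++ y) (≡-sym (zeros-++ m)) (PW.++⁺ M-x M-y)

-- Replacing 2-GNN layers by 1-GNN layers, with error propagation.

module _ {a} (wb : WellBehaved a) where
  open WellBehaved wb

  module _ {p q} (L : Layer2 a p q) where
    open Layer2 L

    -- The receiver's state `x` is decoupled from `f v`: the layer uses `x = f v`, the interpolation
    -- varies `x` over the net with the neighbourhood fixed.
    aggregated : ∀ {ℓ} (G : LGraph ℓ) (f : Signal G p) → Fin (n G) → Vec ℚ p → Vec ℚ r
    aggregated G f v x = aggregate a (List.map (λ w → evalFNN msg (x ++ f w)) (neighbours G v))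

    aggregated-bounded : ∀ {M} → 0ℚ ≤ M → Σ ℚ λ B → 0ℚ ≤ B × (∀ {ℓ} (G : LGraph ℓ) f v {x} →
      (∀ w → Bounded M (f w)) → Bounded M x → Bounded B (aggregated G f v x))
    aggregated-bounded 0≤M with FNN-bounded msg 0≤M
    ... | B , 0≤B , B-msg = B , 0≤B , λ G f v {x} M-f M-x →
      -- Comparing with the aggregate of zero messages, which is zero, makes nonexpansiveness a
      -- bound.
      subst (_≋[ B ] aggregated G f v x) (preserves-zeros (neighbours G v))
        (nonexpansive 0≤B (λ w → B-msg (Bounded-++ M-x (M-f w))) (neighbours G v))

    layer-bounded : ∀ {M} → 0ℚ ≤ M → Σ ℚ λ B → 0ℚ ≤ B × (∀ {ℓ} (G : LGraph ℓ) f →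
      (∀ v → Bounded M (f v)) → ∀ v → Bounded B (applyLayer2 L G f v))
    layer-bounded {M} 0≤M with aggregated-bounded 0≤M
    ... | B₁ , 0≤B₁ , B₁-agg with FNN-bounded comb (+-nonneg 0≤M 0≤B₁)
    ... | B , 0≤B , B-comb = B , 0≤B , λ G f M-f v →
      B-comb (Bounded-++ (≋-weaken (p≤p+q 0≤B₁) (M-f v))
                         (≋-weaken (q≤p+q 0≤M) (B₁-agg G f v M-f (M-f v))))

    layer-lipschitz : Σ ℚ λ K → 0ℚ ≤ K × (∀ {ℓ} (G : LGraph ℓ) {f g : Signal G p} {ε} → 0ℚ ≤ ε →
      (∀ v → f v ≋[ ε ] g v) → ∀ v → applyLayer2 L G f v ≋[ K * ε ] applyLayer2 L G g v)
    layer-lipschitz with FNN-lipschitz msg | FNN-lipschitz comb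
    ... | lip K 0≤K K-msg | lip C 0≤C C-comb =
      -- `comb` receives a state with error `ε` and an aggregate with error `K * ε`; the factor
      -- `1ℚ + K` dominates both.
      C * (1ℚ + K) , *-nonneg 0≤C (+-nonneg 0≤1 0≤K) , λ G {f} {g} {ε} 0≤ε f≋g v →
        subst (applyLayer2 L G f v ≋[_] applyLayer2 L G g v) (≡-sym (*-assoc C (1ℚ + K) ε))
          (C-comb (*-nonneg (+-nonneg 0≤1 0≤K) 0≤ε) (PW.++⁺
            (≋-weaken (ε≤ 0≤ε) (f≋g v))
            (≋-weaken (*-monoˡ K (1ℚ + K) ε 0≤ε (q≤p+q 0≤1))
              (nonexpansive (*-nonneg 0≤K 0≤ε) (λ w → K-msg 0≤ε (PW.++⁺ (f≋g v) (f≋g w)))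
                (neighbours G v)))))
      where
      0≤1 = nonNegative⁻¹ 1ℚ
      ε≤ : ∀ {ε} → 0ℚ ≤ ε → ε ≤ (1ℚ + K) * ε
      ε≤ {ε} 0≤ε = subst (_≤ (1ℚ + K) * ε) (*-identityˡ ε) (*-monoˡ 1ℚ (1ℚ + K) ε 0≤ε (p≤p+q 0≤K))

    -- Each node broadcasts the messages it would send to a receiver in state c, for all c in the net;
    -- the receiver recovers the message meant for its own state by interpolation.
    module Interpolated (K B : ℚ) (cs : List (Vec ℚ p)) where

      message : Vec ℚ p → Vec ℚ p → Vec ℚ r
      message y c = evalFNN msg (c ++ y)

      msg′ : Realisability.Realisable id (λ y → samples (message y) cs)
      msg′ = samples-realisable message cs (λ c → apply msg (pair (const c) input))
        where open Realisability id

      receive : Vec ℚ p × (Vec ℚ p → Vec ℚ r) → Vec ℚ (p ℕ.+ length cs ℕ.* r)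
      receive (x , m) = x ++ samples m cs

      comb′ : Realisability.Realisable receive (λ (x , m) → evalFNN comb (x ++ envelope K B m cs x))
      comb′ = apply comb (pair state (envelope-realisable K B state cs (++-right proj₁ input)))
        where
        open Realisability receive
        state : Realisable proj₁
        state = ++-left {g = λ (x , m) → samples m cs} input

      layer1 : Layer1 a p q
      layer1 = record { r = length cs ℕ.* r ; msg = proj₁ msg′ ; comb = proj₁ comb′ }

      layer1-eval : ∀ {ℓ} (G : LGraph ℓ) f v →
        applyLayer1 layer1 G f v ≡ evalFNN comb (f v ++ envelope K B (aggregated G f v) cs (f v))
      layer1-eval G f v = trans
        (cong (λ u → evalFNN (proj₁ comb′) (f v ++ u)) (trans
          (cong (aggregate a) (List.map-cong (λ w → proj₂ msg′ (f w)) (neighbours G v)))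
          (aggregate-samples wb (λ w → message (f w)) cs (neighbours G v))))
        (proj₂ comb′ (f v , aggregated G f v))

    aggregated-lipschitz : ∀ {ℓ} (G : LGraph ℓ) f v x c → let K = modulus (FNN-lipschitz msg) in
      aggregated G f v x ≋[ K * dist x c ] aggregated G f v c
    aggregated-lipschitz G f v x c = nonexpansive (*-nonneg 0≤K (dist≥0 x c))
      (λ w → K-msg (dist≥0 x c) (PW.++⁺ (≋-dist x c) (≋-refl (dist≥0 x c)))) (neighbours G v)
      where open Lipschitz (FNN-lipschitz msg) renaming (modulus≥0 to 0≤K; close to K-msg)

    layer-approx : ∀ {M ε} → 0ℚ ≤ M → 0ℚ < ε → Σ (Layer1 a p q) λ L′ → ∀ {ℓ} (G : LGraph ℓ) f →
      (∀ v → Bounded M (f v)) → ∀ v → applyLayer2 L G f v ≋[ ε ] applyLayer1 L′ G f v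
    layer-approx {M} {ε} 0≤M 0<ε =
      let open Lipschitz (FNN-lipschitz msg) using () renaming (modulus to K; modulus≥0 to 0≤K)
          open Lipschitz (FNN-lipschitz comb) using () renaming (modulus to C; close to C-comb)
          B , 0≤B , B-agg = aggregated-bounded 0≤M
          -- Tolerances are chosen backwards: `η` is the error that `comb` may receive, and the mesh
          -- `δ` keeps the interpolation error below `η`.
          η , 0<η , Cη≤ε = shrink C 0<ε
          δ , 0<δ , 2Kδ≤η = shrink (K + K) 0<η
          cs , cs-cover = net p M 0<δ
          open Interpolated K B cs
      in layer1 , λ G f M-f v →
        subst (applyLayer2 L G f v ≋[ ε ]_) (≡-sym (layer1-eval G f v))
          (≋-weaken Cη≤ε (C-comb (<⇒≤ 0<η) (PW.++⁺ (≋-refl (<⇒≤ 0<η))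
            (≋-weaken 2Kδ≤η (envelope-approximates (aggregated-lipschitz G f v (f v)) 0≤K (<⇒≤ 0<δ)
              (B-agg G f v M-f (M-f v)) (cs-cover (M-f v)))))))

  run-lipschitz : ∀ {p q} (N : GNN2 a p q) →
    Σ ℚ λ K → 0ℚ ≤ K × (∀ {ℓ} (G : LGraph ℓ) {f g : Signal G p} {ε} →
    0ℚ ≤ ε → (∀ v → f v ≋[ ε ] g v) → ∀ v → runGNN2 N G f v ≋[ K * ε ] runGNN2 N G g v)
  run-lipschitz [] = 1ℚ , nonNegative⁻¹ 1ℚ , λ G {ε = ε} 0≤ε f≋g v →
    ≋-weaken (≤-reflexive (≡-sym (*-identityˡ ε))) (f≋g v)
  run-lipschitz (L ∷ Ls) =
    let K , 0≤K , K-L = layer-lipschitz L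
        K′ , 0≤K′ , K′-Ls = run-lipschitz Ls
    in K′ * K , *-nonneg 0≤K′ 0≤K , λ G {ε = ε} 0≤ε f≋g v →
      ≋-weaken (≤-reflexive (≡-sym (*-assoc K′ K ε))) (K′-Ls G (*-nonneg 0≤K 0≤ε) (K-L G 0≤ε f≋g) v)

  -- A hybrid argument: the error of the first replacement travels through the exact tail `Ls`, and
  -- only then is the tail replaced. Hence all Lipschitz constants belong to the given 2-GNN.
  run-approx : ∀ {p q} (N : GNN2 a p q) {M ε} → 0ℚ ≤ M → 0ℚ < ε →
    Σ (GNN1 a p q) λ N′ → ∀ {ℓ} (G : LGraph ℓ) f →
    (∀ v → Bounded M (f v)) → ∀ v → runGNN2 N G f v ≋[ ε ] runGNN1 N′ G f v
  run-approx [] 0≤M 0<ε = [] , λ G f M-f v → ≋-refl (<⇒≤ 0<ε)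
  run-approx (L ∷ Ls) {M} {ε} 0≤M 0<ε =
    let K , 0≤K , K-Ls = run-lipschitz Ls
        B , 0≤B , B-L = layer-bounded L 0≤M
        δ , 0<δ , Kδ≤½ε = shrink K 0<½ε
        L′ , L′-approx = layer-approx L 0≤M 0<δ
        -- The new tail runs on the output of `L′`, which may leave the ball of radius `B` by `δ`.
        Ls′ , Ls′-approx = run-approx Ls (+-nonneg 0≤B (<⇒≤ 0<δ)) 0<½ε
    in L′ ∷ Ls′ , λ G f M-f v →
      ≋-weaken (≤-reflexive ½ε+½ε≡ε) (≋-trans
        (≋-weaken Kδ≤½ε (K-Ls G (<⇒≤ 0<δ) (L′-approx G f M-f) v))
        (Ls′-approx G (applyLayer1 L′ G f) (λ v → ≋-trans (B-L G f M-f v) (L′-approx G f M-f v)) v))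
    where
    0<½ε : 0ℚ < ½ * ε
    0<½ε = subst (_< ½ * ε) (*-zeroʳ ½) (*-monoʳ-<-pos ½ 0<ε)
    ½ε+½ε≡ε : ½ * ε + ½ * ε ≡ ε
    ½ε+½ε≡ε = trans (≡-sym (*-distribʳ-+ ε ½ ½)) (*-identityˡ ε)

-- Restoring the thresholds by a final layer.

_∷ʳ_ : ∀ {a p q s} → GNN1 a p q → Layer1 a q s → GNN1 a p s
[]      ∷ʳ L = L ∷ []
(M ∷ N) ∷ʳ L = M ∷ (N ∷ʳ L)

run-∷ʳ : ∀ {a p q s ℓ} (N : GNN1 a p q) (L : Layer1 a q s) (G : LGraph ℓ) f →
  runGNN1 (N ∷ʳ L) G f ≡ applyLayer1 L G (runGNN1 N G f)
run-∷ʳ []      L G f = refl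
run-∷ʳ (M ∷ N) L G f = run-∷ʳ N L G (applyLayer1 M G f)

-- The map fixes ½ and doubles distances from it. Messages have dimension 0, so the layer acts on
-- each vertex alone under any aggregation.
amplifier : ∀ {a} → Layer1 a 1 1
amplifier = record
  { r    = 0
  ; msg  = layer (plain ident [])
  ; comb = layer record { A = (2ℚ ∷ []) ∷ [] ; b = - ½ ∷ [] ; σ = ident }
  }
  where 2ℚ = 1ℚ + 1ℚ

-- The summand `0ℚ` is the empty tail of `dot`; it makes the agreement with the layer definitional.
amplify : ℚ → ℚ
amplify x = (1ℚ + 1ℚ) * x + 0ℚ + - ½

amplifier-eval : ∀ {a ℓ} (G : LGraph ℓ) f v →
  Vec.head (applyLayer1 (amplifier {a}) G f v) ≡ amplify (Vec.head (f v))
amplifier-eval {a} G f v = on-singleton (f v) _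
  where
  on-singleton : (x : Vec ℚ 1) (y : Vec ℚ 0) →
    Vec.head (evalFNN (Layer1.comb (amplifier {a})) (x ++ y)) ≡ amplify (Vec.head x)
  on-singleton (x ∷ []) [] = refl

amplify-mono : ∀ {x y} → x ≤ y → amplify x ≤ amplify y
amplify-mono x≤y = +-monoˡ-≤ (- ½) (+-monoˡ-≤ 0ℚ (*-monoˡ-≤-nonNeg (1ℚ + 1ℚ) x≤y))

inputSignal-bounded : ∀ {ℓ} (G : LGraph ℓ) v → Bounded 1ℚ (inputSignal G v)
inputSignal-bounded G v = go _ (λ i → label G v i)
  where
  go : ∀ k (l : Fin k → Bool) → Bounded 1ℚ (Vec.tabulate (λ i → if l i then 1ℚ else 0ℚ))
  go zero    l = []
  go (suc k) l = indicator (l zero) ∷ go k (λ i → l (suc i))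
    where
    indicator : ∀ t → 0ℚ ≈[ 1ℚ ] (if t then 1ℚ else 0ℚ)
    indicator true  = nonNegative⁻¹ (1ℚ + 1ℚ) , ≤-reflexive (≡-sym (+-identityˡ 1ℚ))
    indicator false = nonNegative⁻¹ (0ℚ + 1ℚ) , nonNegative⁻¹ (0ℚ + 1ℚ)

⅛ ¼ ¾ : ℚ
-- Half the distance from either threshold to ½: an error of this size is what doubling about ½
-- compensates.
⅛ = + 1 / 8
¼ = + 1 / 4
¾ = + 3 / 4

head-≋ : ∀ {ε} {x y : Vec ℚ 1} → x ≋[ ε ] y → Vec.head x ≈[ ε ] Vec.head y
head-≋ (x≈y ∷ []) = x≈y

amplify-high : ∀ {x y} → x ≈[ ⅛ ] y → ¾ ≤ x → ¾ ≤ amplify y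
amplify-high {x} {y} (x≤y+⅛ , _) ¾≤x = amplify-mono {¾ - ⅛} {y}
  -- `amplify (¾ - ⅛)` evaluates to `¾`, just as `amplify (¼ + ⅛)` evaluates to `¼` below.
  (p≤q+⇒p-q≤ ¾ ⅛ y (subst (¾ ≤_) (+-comm y ⅛) (≤-trans ¾≤x x≤y+⅛)))

amplify-low : ∀ {x y} → x ≈[ ⅛ ] y → x ≤ ¼ → amplify y ≤ ¼
amplify-low {x} {y} (_ , y≤x+⅛) x≤¼ = amplify-mono {y} {¼ + ⅛} (≤-trans y≤x+⅛ (+-monoˡ-≤ ⅛ x≤¼))

2-GNN⇒1-GNN : ∀ {a} → WellBehaved a → ∀ ℓ (𝒬 : Query ℓ) → Computable2 a 𝒬 → Computable1 a 𝒬
2-GNN⇒1-GNN {a} wb ℓ 𝒬 (N , N-computes) =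
  let N′ , N′-approx = run-approx wb N {ε = ⅛} (nonNegative⁻¹ 1ℚ) (positive⁻¹ ⅛)
      output≡ = λ G v → trans
        (cong (λ S → Vec.head (S v)) (run-∷ʳ N′ amplifier G (inputSignal G)))
        (amplifier-eval {a} G (runGNN1 N′ G (inputSignal G)) v)
      near = λ G v → head-≋ (N′-approx G (inputSignal G) (inputSignal-bounded G) v)
  in (N′ ∷ʳ amplifier) , λ G v →
    (λ v∈𝒬 → subst (¾ ≤_) (≡-sym (output≡ G v)) (amplify-high (near G v) (proj₁ (N-computes G v) v∈𝒬))) ,
    (λ v∉𝒬 → subst (_≤ ¼) (≡-sym (output≡ G v)) (amplify-low (near G v) (proj₂ (N-computes G v) v∉𝒬)))

theorem5p9 : ((ℓ : ℕ) (𝒬 : Query ℓ) → Computable2 MAX 𝒬 → Computable1 MAX 𝒬)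
    × ((ℓ : ℕ) (𝒬 : Query ℓ) → Computable2 MEAN 𝒬 → Computable1 MEAN 𝒬)
theorem5p9 = 2-GNN⇒1-GNN max-wellBehaved , 2-GNN⇒1-GNN mean-wellBehaved
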